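{- Let $n$ be a positive integer. For any permutation $\alpha\in \mathsf{S}_n$ and for any interlocking pair of pointers $p$ and $q$ in $\alpha$, $$\Gamma_n(\mathbf{cds}_{p,q}(\alpha)) = \mathbf{gcds}(\Gamma_n(\alpha),\{p,q\}).$$
   Context: **Permutations and pointers.** $\mathsf{S}_n$ is the set of permutations of $\{1,\dots,n\}$, written as lists $\alpha=[a_1,\dots,a_n]$. An entry $k$ of $\alpha$ has a head pointer $(k,k+1)$, placed immediately to the right of $k$, and a tail pointer $(k-1,k)$, placed immediately to the left of $k$. The pointers $(0,1)$ and $(n,n+1)$ are disregarded, so $\alpha$ has the $n-1$ pointers $(i,i+1)$, $1\le i\le n-1$. Each pointer $(i,i+1)$ occurs exactly twice in $\alpha$: just to the right of $i$ and just to the left of $i+1$. In the gap between two consecutive entries $e,f$ of $\alpha$, the head pointer of $e$ comes before the tail pointer of $f$; thus all occurrences of pointers are linearly ordered from left to right. **Interlocking.** Two distinct pointers $p,q$ interlock in $\alpha$ if their four occurrences appear in the order $p\ldots q\ldots p\ldots q$ or $q\ldots p\ldots q\ldots p$. **The sorting operation cds.** $\mathbf{cds}_{p,q}(\alpha)$ is defined only when $p$ and $q$ interlock in $\alpha$. In that case the four occurrences of $p$ and $q$ cut the list $\alpha$ into five consecutive (possibly empty) blocks of entries, $\alpha = A\,B\,C\,D\,E$, where $B$ is the block between the first and the second of these occurrences, $C$ the block between the second and third, and $D$ the block between the third and the fourth. Then $\mathbf{cds}_{p,q}(\alpha)$ is the permutation $A\,D\,C\,B\,E$, obtained by interchanging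 the blocks $B$ and $D$. **Move graph.** $\Gamma_n(\alpha)$, the move graph (overlap graph) of $\alpha$, is the graph whose vertices are the $n-1$ pointers $(i,i+1)$, $1\le i\le n-1$, with an edge $\{p,q\}$ if and only if $p$ and $q$ interlock in $\alpha$. **The graph transformation gcds.** Let $\mathcal{G}=(V,E)$ be a graph and $\{x,y\}\in E$. The master list of $\{x,y\}$ has two columns: the first consists of all neighbors of $x$ in $\mathcal{G}$ except $y$, the second of all neighbors of $y$ in $\mathcal{G}$ except $x$. The graph $\mathbf{gcds}(\mathcal{G},\{x,y\})=(V,E')$ is defined as follows. Both $x$ and $y$ are isolated in it. For $p\ne q$ in $V\setminus\{x,y\}$: (a) if $p$ or $q$ is not in the master list, then $\{p,q\}\in E'$ iff $\{p,q\}\in E$; (b) if both are in the master list, then: (b.1) if no column contains both $p$ and $q$, then $\{p,q\}\in E'$ iff $\{p,q\}\notin E$; (b.2) if some column contains both and the total number of occurrences of $p$ and $q$ in the master list (both columns together) is even, then $\{p,q\}\in E'$ iff $\{p,q\}\in E$; (b.3) if some column contains both and that total number is odd, then $\{p,q\}\in E'$ iff $\{p,q\}\notin E$. -}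

module Defs where

open import Data.Bool.Base using (true; false; if_then_else_)
open import Data.Fin.Base using (Fin; toℕ)
open import Data.Fin.Properties as Fin using ()
open import Data.List.Base using (List; []; _∷_; _++_; concat; concatMap; filter; length; map; upTo; allFin)
open import Data.List.Membership.DecPropositional using (_∈?_)
open import Data.List.Membership.Propositional using (_∈_)
open import Data.List.NonEmpty.Base as List⁺ using (List⁺; _∷_; toList)
open import Data.List.Properties using (≡-dec; filter-≐; ++-identityʳ)
open import Data.List.Relation.Binary.Permutation.Propositional using (_↭_; ↭-trans; ↭-reflexive; module PermutationReasoning)
open import Data.List.Relation.Binary.Permutation.Propositional.Properties using (++⁺ˡ; shifts)
open import Data.Nat.Base using (ℕ; suc; pred; _+_; _∸_)
open import Data.Nat.Divisibility using (_∣_; _∤_; _∣?_)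
open import Data.Nat.Properties using (_≟_; +-comm)
open import Data.Product.Base using (_×_; _,_)
open import Data.Sum.Base as Sum using (_⊎_; inj₁; inj₂)
open import Function.Base using (_∘_)
open import Function.Bundles using (_⇔_)
open import Level using (0ℓ)
open import Relation.Binary.Core using (Rel)
open import Relation.Binary.Definitions using (Decidable; Symmetric; Irreflexive)
open import Relation.Binary.PropositionalEquality using (_≡_; _≢_; refl; sym; trans; cong; subst)
open import Relation.Nullary.Decidable using (Dec; yes; no; does; map′; ¬?; _×-dec_; _⊎-dec_)
open import Relation.Nullary.Negation using (¬_)

record Graph (m : ℕ) : Set₁ where
  field
    Edge   : Rel (Fin m) 0ℓ
    edge?  : Decidable Edge
    symm   : Symmetric Edge
    irrefl : Irreflexive _≡_ Edge

open Graph public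

infix 4 _≈ᴳ_

_≈ᴳ_ : ∀ {m} → Graph m → Graph m → Set
G ≈ᴳ H = ∀ u v → Edge G u v ⇔ Edge H u v

module _ {m : ℕ} (G : Graph m) where

  column : Fin m → Fin m → List (Fin m)
  column x y = filter (λ v → edge? G x v ×-dec ¬? (v Fin.≟ y)) (allFin m)

  masterList : Fin m → Fin m → List (Fin m)
  masterList x y = column x y ++ column y x

  occurrences : Fin m → List (Fin m) → ℕ
  occurrences v = length ∘ filter (v Fin.≟_)

  module _ (x y : Fin m) where

    Listed : Fin m → Set
    Listed v = v ∈ masterList x y

    ShareColumn : Fin m → Fin m → Set
    ShareColumn p q = (p ∈ column x y × q ∈ column x y)
                    ⊎ (p ∈ column y x × q ∈ column y x)

    total : Fin m → Fin m → ℕ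
    total p q = occurrences p (masterList x y) + occurrences q (masterList x y)

    data Updated (p q : Fin m) : Set where
      unlisted  : ¬ Listed p ⊎ ¬ Listed q → Edge G p q → Updated p q
      noShare   : Listed p → Listed q → ¬ ShareColumn p q → ¬ Edge G p q → Updated p q
      shareEven : Listed p → Listed q → ShareColumn p q → 2 ∣ total p q → Edge G p q → Updated p q
      shareOdd  : Listed p → Listed q → ShareColumn p q → 2 ∤ total p q → ¬ Edge G p q → Updated p q

    Other : Fin m → Set
    Other v = v ≢ x × v ≢ y

    GcdsEdge : Rel (Fin m) 0ℓ
    GcdsEdge p q = p ≢ q × Other p × Other q × Updated p q

    listed? : ∀ v → Dec (Listed v)
    listed? v = _∈?_ Fin._≟_ v (masterList x y)

    share? : Decidable ShareColumn
    share? p q = ((p ∈′ column x y) ×-dec (q ∈′ column x y))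
           ⊎-dec ((p ∈′ column y x) ×-dec (q ∈′ column y x))
      where _∈′_ = _∈?_ Fin._≟_

    updated? : Decidable Updated
    updated? p q with listed? p | listed? q
    ... | no p∉ | _ = map′ (unlisted (inj₁ p∉))
      (λ { (unlisted _ e) → e
         ; (noShare p∈ _ _ _) → contra p∈ ; (shareEven p∈ _ _ _ _) → contra p∈
         ; (shareOdd p∈ _ _ _ _) → contra p∈ })
      (edge? G p q)
      where contra : ∀ {A : Set} → Listed p → A
            contra p∈ with () ← p∉ p∈
    ... | yes _ | no q∉ = map′ (unlisted (inj₂ q∉))
      (λ { (unlisted _ e) → e
         ; (noShare _ q∈ _ _) → contra q∈ ; (shareEven _ q∈ _ _ _) → contra q∈
         ; (shareOdd _ q∈ _ _ _) → contra q∈ })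
      (edge? G p q)
      where contra : ∀ {A : Set} → Listed q → A
            contra q∈ with () ← q∉ q∈
    ... | yes p∈ | yes q∈ with share? p q | 2 ∣? total p q | edge? G p q
    ... | no ¬s | _      | no ¬e = yes (noShare p∈ q∈ ¬s ¬e)
    ... | yes s | yes ev | yes e = yes (shareEven p∈ q∈ s ev e)
    ... | yes s | no odd | no ¬e = yes (shareOdd p∈ q∈ s odd ¬e)
    ... | no ¬s | _      | yes e = no λ
      { (unlisted (inj₁ p∉) _) → p∉ p∈ ; (unlisted (inj₂ q∉) _) → q∉ q∈
      ; (noShare _ _ _ ¬e) → ¬e e ; (shareEven _ _ s _ _) → ¬s s ; (shareOdd _ _ s _ _) → ¬s s }
    ... | yes s | yes ev | no ¬e = no λ
      { (unlisted _ e) → ¬e e ; (noShare _ _ ¬s _) → ¬s s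
      ; (shareEven _ _ _ _ e) → ¬e e ; (shareOdd _ _ _ odd _) → odd ev }
    ... | yes s | no odd | yes e = no λ
      { (unlisted (inj₁ p∉) _) → p∉ p∈ ; (unlisted (inj₂ q∉) _) → q∉ q∈
      ; (noShare _ _ ¬s _) → ¬s s ; (shareEven _ _ _ ev _) → odd ev ; (shareOdd _ _ _ _ ¬e) → ¬e e }

    share-sym : Symmetric ShareColumn
    share-sym = Sum.map (λ (a , b) → b , a) (λ (a , b) → b , a)

    total-comm : ∀ p q → total p q ≡ total q p
    total-comm p q = +-comm (occurrences p (masterList x y)) (occurrences q (masterList x y))

    updated-sym : Symmetric Updated
    updated-sym (unlisted p⊎q e)         = unlisted (Sum.swap p⊎q) (symm G e)
    updated-sym (noShare p∈ q∈ ¬s ¬e)    = noShare q∈ p∈ (¬s ∘ share-sym) (¬e ∘ symm G)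
    updated-sym {p} {q} (shareEven p∈ q∈ s ev e) =
      shareEven q∈ p∈ (share-sym s) (subst (2 ∣_) (total-comm p q) ev) (symm G e)
    updated-sym {p} {q} (shareOdd p∈ q∈ s odd ¬e) =
      shareOdd q∈ p∈ (share-sym s) (subst (2 ∤_) (total-comm p q) odd) (¬e ∘ symm G)

  -- gcds is defined only at an edge; the new graph does not depend on the proof.
  gcds : (x y : Fin m) → Edge G x y → Graph m
  gcds x y _ = record
    { Edge   = GcdsEdge x y
    ; edge?  = λ p q → ¬? (p Fin.≟ q) ×-dec other? p ×-dec other? q ×-dec updated? x y p q
    ; symm   = λ (p≢q , op , oq , u) → p≢q ∘ sym , oq , op , updated-sym x y u
    ; irrefl = λ p≡q (p≢q , _) → p≢q p≡q
    }
    where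
    other? : ∀ v → Dec (Other x y v)
    other? v = ¬? (v Fin.≟ x) ×-dec ¬? (v Fin.≟ y)

record Perm (n : ℕ) : Set where
  constructor perm
  field
    entries : List ℕ
    isPerm  : entries ↭ map suc (upTo n)

open Perm public

Pointer : ℕ → Set
Pointer n = Fin (n ∸ 1)

-- The pointer (i,i+1), 1 ≤ i ≤ n-1, is encoded in words by the number i.
label : ∀ {m} → Fin m → ℕ
label p = suc (toℕ p)

data Symbol : Set where
  entry pointer : ℕ → Symbol

-- The entry k is preceded by its tail pointer (k-1,k) and followed by its head
-- pointer (k,k+1).  The disregarded pointers (0,1) and (n,n+1) occur in this
-- word, but they are never the label of a 'Pointer n', hence have no influence
-- on anything below.
word : List ℕ → List Symbol
word = concatMap (λ k → pointer (pred k) ∷ entry k ∷ pointer k ∷ [])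

OneOf : ℕ → ℕ → ℕ → Set
OneOf p q i = i ≡ p ⊎ i ≡ q

oneOf? : ∀ p q i → Dec (OneOf p q i)
oneOf? p q i = (i ≟ p) ⊎-dec (i ≟ q)

pointers : List Symbol → List ℕ
pointers []              = []
pointers (entry _   ∷ w) = pointers w
pointers (pointer i ∷ w) = i ∷ pointers w

trace : ℕ → ℕ → List ℕ → List ℕ
trace p q = filter (oneOf? p q) ∘ pointers ∘ word

Interlock : ∀ {n} → Perm n → Pointer n → Pointer n → Set
Interlock {n} α p q = p ≢ q × (t ≡ p′ ∷ q′ ∷ p′ ∷ q′ ∷ [] ⊎ t ≡ q′ ∷ p′ ∷ q′ ∷ p′ ∷ [])
  where
  p′ = label p
  q′ = label q
  t  = trace p′ q′ (entries α)

trace-sym : ∀ p q as → trace p q as ≡ trace q p as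
trace-sym p q as = filter-≐ (oneOf? p q) (oneOf? q p) (Sum.swap , Sum.swap) (pointers (word as))

interlock? : ∀ {n} (α : Perm n) → Decidable (Interlock α)
interlock? α p q = ¬? (p Fin.≟ q) ×-dec (≡-dec _≟_ _ _ ⊎-dec ≡-dec _≟_ _ _)

interlock-sym : ∀ {n} (α : Perm n) → Symmetric (Interlock α)
interlock-sym {n} α {p} {q} (p≢q , t≡) = p≢q ∘ sym , Sum.swap (Sum.map flip flip t≡)
  where
  flip : ∀ {w} → trace (label p) (label q) (entries α) ≡ w →
         trace (label q) (label p) (entries α) ≡ w
  flip = trans (trace-sym (label q) (label p) (entries α))

Γ : ∀ n → Perm n → Graph (n ∸ 1)
Γ n α = record
  { Edge   = Interlock α
  ; edge?  = interlock? α
  ; symm   = λ {p} {q} → interlock-sym α {p} {q}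
  ; irrefl = λ p≡q (p≢q , _) → p≢q p≡q
  }

cut : ℕ → ℕ → List Symbol → List⁺ (List ℕ)
cut p q []              = [] ∷ []
cut p q (entry k   ∷ w) = let b ∷ bs = cut p q w in (k ∷ b) ∷ bs
cut p q (pointer i ∷ w) =
  if does (oneOf? p q i) then [] ∷ toList (cut p q w) else cut p q w

exchange : (bs : List⁺ (List ℕ)) → List⁺.length bs ≡ 5 → List ℕ
exchange (A ∷ B ∷ C ∷ D ∷ E ∷ []) refl = A ++ D ++ C ++ B ++ E

length-cut : ∀ p q w →
  List⁺.length (cut p q w) ≡ suc (length (filter (oneOf? p q) (pointers w)))
length-cut p q []              = refl
length-cut p q (entry k   ∷ w) = length-cut p q w
length-cut p q (pointer i ∷ w) with does (oneOf? p q i)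
... | true  = cong suc (length-cut p q w)
... | false = length-cut p q w

module _ {n : ℕ} (p q : Pointer n) (α : Perm n) where

  private
    p′ = label p
    q′ = label q

  blocks : List⁺ (List ℕ)
  blocks = cut p′ q′ (word (entries α))

  fiveBlocks : Interlock α p q → List⁺.length blocks ≡ 5
  fiveBlocks (_ , t≡) = trans (length-cut p′ q′ (word (entries α)))
    (cong suc (Sum.[ cong length , cong length ] t≡))

entriesOf : List Symbol → List ℕ
entriesOf []              = []
entriesOf (entry k   ∷ w) = k ∷ entriesOf w
entriesOf (pointer _ ∷ w) = entriesOf w

concat-cut : ∀ p q w → concat (toList (cut p q w)) ≡ entriesOf w
concat-cut p q []              = refl
concat-cut p q (entry k   ∷ w) = cong (k ∷_) (concat-cut p q w)
concat-cut p q (pointer i ∷ w) with does (oneOf? p q i)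
... | true  = concat-cut p q w
... | false = concat-cut p q w

entriesOf-word : ∀ as → entriesOf (word as) ≡ as
entriesOf-word []       = refl
entriesOf-word (k ∷ as) = cong (k ∷_) (entriesOf-word as)

exchange-↭ : ∀ bs len → exchange bs len ↭ concat (toList bs)
exchange-↭ (A ∷ B ∷ C ∷ D ∷ E ∷ []) refl = ++⁺ˡ A (begin
  D ++ C ++ B ++ E      ↭⟨ ++⁺ˡ D (shifts C B) ⟩
  D ++ B ++ C ++ E      ↭⟨ shifts D B ⟩
  B ++ D ++ C ++ E      ↭⟨ ++⁺ˡ B (shifts D C) ⟩
  B ++ C ++ D ++ E      ≡⟨ cong (λ z → B ++ C ++ D ++ z) (++-identityʳ E) ⟨
  B ++ C ++ D ++ E ++ [] ∎)
  where open PermutationReasoning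

cds : ∀ {n} (p q : Pointer n) (α : Perm n) → Interlock α p q → Perm n
cds p q α I = record
  { entries = exchange bs len
  ; isPerm  = ↭-trans (exchange-↭ bs len)
             (↭-trans (↭-reflexive (trans (concat-cut (label p) (label q) (word (entries α)))
                                          (entriesOf-word (entries α))))
                      (isPerm α))
  }
  where
  bs  = blocks p q α
  len = fiveBlocks p q α I

{-# OPTIONS --safe #-}
module Submission where

-- If r and s both occur twice in a word, they interlock there exactly when the
-- number of pairs (occurrence of r before occurrence of s) is odd.  This parity
-- is additive under concatenation up to a bilinear term, so exchanging the blocks
-- B and D changes it by P_r Q_s + Q_r P_s over 𝔽₂, where P_r and Q_r tell whether
-- r interlocks with p and with q.  The master list rules of gcds are a case
-- distinction for the same polynomial.  The pointers p and q become isolated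
-- because cds makes the entries k and k + 1 adjacent for both pointers (k, k + 1).

open import Data.Bool.Base using (Bool; true; false; not; _∧_; _∨_; _xor_; if_then_else_)
open import Data.Bool.Properties as Bool using (xor-assoc; xor-comm; xor-identityʳ)
open import Data.Bool.Solver using (module xor-∧-Solver)
open import Data.Empty using (⊥-elim)
open import Data.Fin.Base using (Fin; toℕ)
open import Data.Fin.Properties as Fin using (toℕ-injective; toℕ<n)
open import Data.List.Base using (List; []; _∷_; _++_; concat; filter; length; map; allFin)
open import Data.List.Membership.Propositional using (_∈_)
open import Data.List.Membership.Propositional.Properties
  using (∈-++⁺ˡ; ∈-++⁺ʳ; ∈-++⁻; ∈-filter⁺; ∈-filter⁻; ∈-allFin; ∈-map⁺; ∈-upTo⁺)
open import Data.List.NonEmpty.Base as List⁺ using (List⁺; _∷_; toList)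
open import Data.List.Properties
  using (++-assoc; ++-identityʳ; length-++; filter-++; filter-accept; filter-reject; filter-none; concatMap-++)
open import Data.List.Relation.Binary.Permutation.Propositional using (↭-sym; ↭⇒↭ₛ)
open import Data.List.Relation.Binary.Permutation.Propositional.Properties using (∈-resp-↭)
import Data.List.Relation.Binary.Permutation.Setoid.Properties as Permutation
open import Data.List.Relation.Unary.All as All using (All; []; _∷_)
open import Data.List.Relation.Unary.All.Properties using (all-filter)
open import Data.List.Relation.Unary.AllPairs using ([]; _∷_)
open import Data.List.Relation.Unary.Any using (here; there)
open import Data.List.Relation.Unary.Linked using (Linked; [-]; _∷_)
open import Data.List.Relation.Unary.Unique.Propositional using (Unique)
open import Data.List.Relation.Unary.Unique.Propositional.Properties as Unique using ()
open import Data.Nat.Base using (ℕ; zero; suc; pred; _+_; _<_; _≡ᵇ_; s≤s; NonZero)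
open import Data.Nat.Divisibility using (_∣?_)
open import Data.Nat.Properties using (_≟_; suc-injective; +-suc; m+n≤o⇒n≤o)
open import Data.Product.Base using (∃; ∃₂; _×_; _,_; proj₁; proj₂)
open import Data.Product.Function.NonDependent.Propositional using (_×-⇔_)
open import Data.Sum.Base as Sum using (_⊎_; inj₁; inj₂)
open import Data.Sum.Function.Propositional using (_⊎-⇔_)
open import Data.Unit.Base using (⊤; tt)
open import Function.Base using (_∘_)
open import Function.Bundles using (_⇔_; mk⇔; Equivalence)
open import Relation.Binary.Definitions using (DecidableEquality)
open import Relation.Binary.PropositionalEquality
  using (_≡_; _≢_; refl; sym; trans; cong; cong₂; subst; setoid; module ≡-Reasoning)
open import Relation.Nullary.Decidable using (Dec; yes; no; does; dec-true; dec-false; does-⇔; ¬?; _×-dec_; _⊎-dec_)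
open import Relation.Nullary.Negation using (¬_; contradiction)

open import Defs

private
  variable
    n : ℕ

-- Boolean tests and multiplicities in lists

≡ᵇ-refl : ∀ k → (k ≡ᵇ k) ≡ true
≡ᵇ-refl k = dec-true (k ≟ k) refl

≢⇒≡ᵇ-false : ∀ {k l} → k ≢ l → (k ≡ᵇ l) ≡ false
≢⇒≡ᵇ-false {k} {l} = dec-false (k ≟ l)

if-does : ∀ {A X Y : Set} (a? : Dec A) → (A → X) → (¬ A → Y) → if does a? then X else Y
if-does (yes a) f g = f a
if-does (no ¬a) f g = g ¬a

module _ {A : Set} (_≟ᴬ_ : DecidableEquality A) where

  count : A → List A → ℕ
  count x xs = length (filter (x ≟ᴬ_) xs)

  count-∉ : ∀ {x xs} → ¬ x ∈ xs → count x xs ≡ 0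
  count-∉ {x} x∉xs =
    cong length (filter-none (x ≟ᴬ_) (All.tabulate λ y∈xs x≡y → x∉xs (subst (_∈ _) (sym x≡y) y∈xs)))

  count-Unique : ∀ {x xs} → Unique xs → x ∈ xs → count x xs ≡ 1
  count-Unique {x} {y ∷ xs} (y∉xs ∷ xs!) x∈ with x ≟ᴬ y | x∈
  ... | yes refl | _          = cong suc (count-∉ (λ x∈xs → All.lookup y∉xs x∈xs refl))
  ... | no x≢y   | here x≡y   = contradiction x≡y x≢y
  ... | no _     | there x∈xs = count-Unique xs! x∈xs

Unique-++⇒disjoint : ∀ {A : Set} {x : A} (xs : List A) {ys} →
                     Unique (xs ++ ys) → x ∈ xs → ¬ x ∈ ys
Unique-++⇒disjoint (_ ∷ xs) (x∉ ∷ _)  (here refl) x∈ys = All.lookup x∉ (∈-++⁺ʳ xs x∈ys) refl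
Unique-++⇒disjoint (_ ∷ xs) (_ ∷ xs!) (there x∈)  x∈ys = Unique-++⇒disjoint xs xs! x∈ x∈ys

-- Parities of occurrences and crossings

parity : ℕ → List ℕ → Bool
parity r []      = false
parity r (x ∷ u) = (r ≡ᵇ x) xor parity r u

crossings : ℕ → ℕ → List ℕ → Bool
crossings r s []      = false
crossings r s (x ∷ u) = ((r ≡ᵇ x) ∧ parity s u) xor crossings r s u

parity-++ : ∀ r u v → parity r (u ++ v) ≡ parity r u xor parity r v
parity-++ r []      v = refl
parity-++ r (x ∷ u) v =
  trans (cong ((r ≡ᵇ x) xor_) (parity-++ r u v)) (sym (xor-assoc (r ≡ᵇ x) _ _))

-- A pair not contained in one of the two factors takes `r` from `u` and `s` from `v`; the product
-- of parities counts these mixed pairs.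
crossings-++ : ∀ r s u v →
  crossings r s (u ++ v) ≡ (crossings r s u xor crossings r s v) xor (parity r u ∧ parity s v)
crossings-++ r s []      v = sym (xor-identityʳ _)
crossings-++ r s (x ∷ u) v = trans
  (cong₂ (λ a b → ((r ≡ᵇ x) ∧ a) xor b) (parity-++ s u v) (crossings-++ r s u v))
  (solve 6 (λ e su sv cu cv ru →
      (e :* (su :+ sv)) :+ ((cu :+ cv) :+ ru :* sv)
      := (((e :* su) :+ cu) :+ cv) :+ (e :+ ru) :* sv)
    refl (r ≡ᵇ x) (parity s u) (parity s v) (crossings r s u) (crossings r s v) (parity r u))
  where open xor-∧-Solver

word-pointers : List ℕ → List ℕ
word-pointers as = pointers (word as)

pointers-++ : ∀ v w → pointers (v ++ w) ≡ pointers v ++ pointers w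
pointers-++ []              w = refl
pointers-++ (entry _   ∷ v) w = pointers-++ v w
pointers-++ (pointer i ∷ v) w = cong (i ∷_) (pointers-++ v w)

word-pointers-++ : ∀ as bs → word-pointers (as ++ bs) ≡ word-pointers as ++ word-pointers bs
word-pointers-++ as bs = trans (cong pointers (concatMap-++ _ as bs)) (pointers-++ (word as) (word bs))

-- Alternation of two labels

trues falses : List Bool → ℕ
trues []           = 0
trues (true  ∷ bs) = suc (trues bs)
trues (false ∷ bs) = trues bs
falses []           = 0
falses (true  ∷ bs) = falses bs
falses (false ∷ bs) = suc (falses bs)

module _ (r s : ℕ) where

  private
    -- Words in two labels are coded by boolean lists, so that the finite case analysis below can
    -- match on constructors instead of testing numbers for equality.
    select : Bool → ℕ
    select true  = r
    select false = s

  module _ (r≢s : r ≢ s) where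

    private
      encode : ∀ {t} → All (OneOf r s) t → ∃ λ bs → t ≡ map select bs
      encode []               = [] , refl
      encode (inj₁ refl ∷ ps) with bs , refl ← encode ps = true ∷ bs , refl
      encode (inj₂ refl ∷ ps) with bs , refl ← encode ps = false ∷ bs , refl

      count-trues : ∀ bs → count _≟_ r (map select bs) ≡ trues bs
      count-trues []           = refl
      count-trues (true  ∷ bs) rewrite ≡ᵇ-refl r = cong suc (count-trues bs)
      count-trues (false ∷ bs) rewrite ≢⇒≡ᵇ-false r≢s = count-trues bs

      count-falses : ∀ bs → count _≟_ s (map select bs) ≡ falses bs
      count-falses []           = refl
      count-falses (true  ∷ bs) rewrite ≢⇒≡ᵇ-false (r≢s ∘ sym) = count-falses bs
      count-falses (false ∷ bs) rewrite ≡ᵇ-refl s = cong suc (count-falses bs)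

      -- `false` codes `s`, hence the negation: this is the parity of the number of `false`.
      parityᵇ : List Bool → Bool
      parityᵇ []       = false
      parityᵇ (b ∷ bs) = not b xor parityᵇ bs

      crossingsᵇ : List Bool → Bool
      crossingsᵇ []       = false
      crossingsᵇ (b ∷ bs) = (b ∧ parityᵇ bs) xor crossingsᵇ bs

      r≡ᵇselect : ∀ b → (r ≡ᵇ select b) ≡ b
      r≡ᵇselect true  = ≡ᵇ-refl r
      r≡ᵇselect false = ≢⇒≡ᵇ-false r≢s

      s≡ᵇselect : ∀ b → (s ≡ᵇ select b) ≡ not b
      s≡ᵇselect true  = ≢⇒≡ᵇ-false (r≢s ∘ sym)
      s≡ᵇselect false = ≡ᵇ-refl s

      parity-select : ∀ bs → parity s (map select bs) ≡ parityᵇ bs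
      parity-select []       = refl
      parity-select (b ∷ bs) = cong₂ _xor_ (s≡ᵇselect b) (parity-select bs)

      crossings-select : ∀ bs → crossings r s (map select bs) ≡ crossingsᵇ bs
      crossings-select []       = refl
      crossings-select (b ∷ bs) =
        cong₂ _xor_ (cong₂ _∧_ (r≡ᵇselect b) (parity-select bs)) (crossings-select bs)

      -- The hypotheses have the form to which `trues` and `falses` reduce once two of each symbol
      -- have been read.
      exhausted : ∀ bs → suc (suc (trues bs)) ≡ 2 → suc (suc (falses bs)) ≡ 2 → bs ≡ []
      exhausted []           _  _  = refl
      exhausted (true  ∷ bs) () _
      exhausted (false ∷ bs) _  ()

      -- Two `true` and two `false` have six arrangements. The alternating ones have 3 and 1
      -- crossings, the other four have 4, 2, 2 and 0, so parity separates them. All other list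
      -- shapes contradict the two counts.
      classify : ∀ bs → trues bs ≡ 2 → falses bs ≡ 2 → crossingsᵇ bs ≡ true →
                 bs ≡ true ∷ false ∷ true ∷ false ∷ [] ⊎ bs ≡ false ∷ true ∷ false ∷ true ∷ []
      classify (true  ∷ false ∷ true  ∷ false ∷ bs) t f _ = inj₁ (cong (λ z → _ ∷ _ ∷ _ ∷ _ ∷ z) (exhausted bs t f))
      classify (false ∷ true  ∷ false ∷ true  ∷ bs) t f _ = inj₂ (cong (λ z → _ ∷ _ ∷ _ ∷ _ ∷ z) (exhausted bs t f))
      classify (true  ∷ true  ∷ false ∷ false ∷ bs) t f c with refl ← exhausted bs t f with () ← c
      classify (true  ∷ false ∷ false ∷ true  ∷ bs) t f c with refl ← exhausted bs t f with () ← c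
      classify (false ∷ true  ∷ true  ∷ false ∷ bs) t f c with refl ← exhausted bs t f with () ← c
      classify (false ∷ false ∷ true  ∷ true  ∷ bs) t f c with refl ← exhausted bs t f with () ← c

    alternating⇔crossings : ∀ {t} → All (OneOf r s) t → count _≟_ r t ≡ 2 → count _≟_ s t ≡ 2 →
      (t ≡ r ∷ s ∷ r ∷ s ∷ [] ⊎ t ≡ s ∷ r ∷ s ∷ r ∷ []) ⇔ (crossings r s t ≡ true)
    alternating⇔crossings ps r² s² with bs , refl ← encode ps = mk⇔
      (Sum.[ (λ t≡ → trans (cong (crossings r s) t≡) (crossings-select (true ∷ false ∷ true ∷ false ∷ [])))
           , (λ t≡ → trans (cong (crossings r s) t≡) (crossings-select (false ∷ true ∷ false ∷ true ∷ []))) ])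
      (λ c → Sum.map (cong (map select)) (cong (map select))
        (classify bs (trans (sym (count-trues bs)) r²) (trans (sym (count-falses bs)) s²)
          (trans (sym (crossings-select bs)) c)))

-- Restriction to two labels, and multiplicities of labels in a permutation

count-filter-oneOf : ∀ r s {x} → OneOf r s x → ∀ u →
  count _≟_ x (filter (oneOf? r s) u) ≡ count _≟_ x u
count-filter-oneOf r s x∈ []      = refl
count-filter-oneOf r s {x} x∈ (y ∷ u) with oneOf? r s y
... | yes y∈ rewrite filter-accept (oneOf? r s) {xs = u} y∈ with does (x ≟ y)
...   | true  = cong suc (count-filter-oneOf r s x∈ u)
...   | false = count-filter-oneOf r s x∈ u
count-filter-oneOf r s {x} x∈ (y ∷ u) | no y∉
  rewrite filter-reject (oneOf? r s) {xs = u} y∉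
        | ≢⇒≡ᵇ-false {x} {y} (λ { refl → y∉ x∈ }) = count-filter-oneOf r s x∈ u

parity-filter-oneOf : ∀ r s {x} → OneOf r s x → ∀ u →
  parity x (filter (oneOf? r s) u) ≡ parity x u
parity-filter-oneOf r s x∈ []      = refl
parity-filter-oneOf r s {x} x∈ (y ∷ u) with oneOf? r s y
... | yes y∈ rewrite filter-accept (oneOf? r s) {xs = u} y∈ =
  cong ((x ≡ᵇ y) xor_) (parity-filter-oneOf r s x∈ u)
... | no y∉ rewrite filter-reject (oneOf? r s) {xs = u} y∉ | ≢⇒≡ᵇ-false {x} {y} (λ { refl → y∉ x∈ }) =
  parity-filter-oneOf r s x∈ u

-- Other labels contribute nothing. This trades the trace in `Interlock` for the full pointer word,
-- to which the concatenation formulas apply for all pairs of labels at once.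
crossings-filter-oneOf : ∀ r s u → crossings r s (filter (oneOf? r s) u) ≡ crossings r s u
crossings-filter-oneOf r s []      = refl
crossings-filter-oneOf r s (y ∷ u) with oneOf? r s y
... | yes y∈ rewrite filter-accept (oneOf? r s) {xs = u} y∈ = cong₂ (λ a b → ((r ≡ᵇ y) ∧ a) xor b)
                (parity-filter-oneOf r s (inj₂ refl) u) (crossings-filter-oneOf r s u)
... | no y∉ rewrite filter-reject (oneOf? r s) {xs = u} y∉ | ≢⇒≡ᵇ-false {r} {y} (y∉ ∘ inj₁ ∘ sym) =
  crossings-filter-oneOf r s u

-- The label r + 1 is the head pointer of the entry r + 1 and the tail pointer of the entry r + 2.
-- The formula fails for label 0, because an entry 0 would carry it on both sides; hence the
-- successors.
count-word-pointers : ∀ r as →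
  count _≟_ (suc r) (word-pointers as) ≡ count _≟_ (suc r) as + count _≟_ (suc (suc r)) as
count-word-pointers r []           = refl
count-word-pointers r (zero  ∷ as) = count-word-pointers r as
count-word-pointers r (suc k ∷ as) with suc r ≡ᵇ k
count-word-pointers r (suc k ∷ as) | true with r ≡ᵇ k
-- `k` cannot equal both `r` and `suc r`, but the equation holds formally here too, so no
-- contradiction has to be derived.
... | true  = cong suc (trans (cong suc (count-word-pointers r as)) (sym (+-suc _ _)))
... | false = trans (cong suc (count-word-pointers r as)) (sym (+-suc _ _))
count-word-pointers r (suc k ∷ as) | false with r ≡ᵇ k
... | true  = cong suc (count-word-pointers r as)
... | false = count-word-pointers r as

module _ (α : Perm n) where

  entries-Unique : Unique (entries α)
  entries-Unique = Permutation.Unique-resp-↭ (setoid ℕ) (↭⇒↭ₛ (↭-sym (isPerm α)))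
    (Unique.map⁺ suc-injective (Unique.upTo⁺ n))

  ∈-entries : ∀ {k} → k < n → suc k ∈ entries α
  ∈-entries k<n = ∈-resp-↭ (↭-sym (isPerm α)) (∈-map⁺ suc (∈-upTo⁺ k<n))

suc-toℕ<n : (r : Pointer n) → suc (toℕ r) < n
suc-toℕ<n {suc n} r = s≤s (toℕ<n r)

-- Both k and k + 1 are entries because a pointer label lies between 1 and n - 1; the disregarded
-- labels 0 and n would occur only once.
count-label : (α : Perm n) (r : Pointer n) → count _≟_ (label r) (word-pointers (entries α)) ≡ 2
count-label α r = trans (count-word-pointers (toℕ r) (entries α)) (cong₂ _+_
  (count-Unique _≟_ (entries-Unique α) (∈-entries α (m+n≤o⇒n≤o 1 (suc-toℕ<n r))))
  (count-Unique _≟_ (entries-Unique α) (∈-entries α (suc-toℕ<n r))))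

crosses : Perm n → Pointer n → Pointer n → Bool
crosses α r s = crossings (label r) (label s) (word-pointers (entries α))

label-injective : ∀ {m} {r s : Fin m} → label r ≡ label s → r ≡ s
label-injective = toℕ-injective ∘ suc-injective

interlock⇔crosses : (α : Perm n) {r s : Pointer n} → r ≢ s →
                    Interlock α r s ⇔ (crosses α r s ≡ true)
interlock⇔crosses α {r} {s} r≢s = mk⇔
  (λ (_ , t≡) → trans (sym filtered) (to t≡))
  (λ c → r≢s , from (trans filtered c))
  where
  filtered = crossings-filter-oneOf (label r) (label s) (word-pointers (entries α))
  open Equivalence (alternating⇔crossings (label r) (label s) (r≢s ∘ label-injective)
    (all-filter (oneOf? (label r) (label s)) (word-pointers (entries α)))
    (trans (count-filter-oneOf (label r) (label s) (inj₁ refl) (word-pointers (entries α))) (count-label α r))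
    (trans (count-filter-oneOf (label r) (label s) (inj₂ refl) (word-pointers (entries α))) (count-label α s)))

-- Isolation of the two exchanged pointers

Adjacent : ℕ → List ℕ → Set
Adjacent k as = ∃₂ λ xs ys → as ≡ xs ++ k ∷ suc k ∷ ys

¬Linked-repeat : ∀ {k : ℕ} xs {ys} → ¬ Linked _≢_ (xs ++ k ∷ k ∷ ys)
¬Linked-repeat []           (k≢k ∷ _) = k≢k refl
¬Linked-repeat (x ∷ [])     (_ ∷ l)   = ¬Linked-repeat [] l
¬Linked-repeat (x ∷ y ∷ xs) (_ ∷ l)   = ¬Linked-repeat (y ∷ xs) l

-- The head pointer of k and the tail pointer of k + 1 are both labelled k, with no pointer between
-- them. So the trace repeats k, which an alternating trace never does.
Adjacent⇒¬Interlock : (α : Perm n) (r s : Pointer n) → Adjacent (label r) (entries α) → ¬ Interlock α r s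
Adjacent⇒¬Interlock α r s (xs , ys , as≡) (r≢s , t≡) =
  ¬Linked-repeat _ (subst (Linked _≢_) trace-repeat (alternating t≡))
  where
  k = label r
  l = label s
  k≢l : k ≢ l
  k≢l = r≢s ∘ label-injective
  alternating : ∀ {t} → t ≡ k ∷ l ∷ k ∷ l ∷ [] ⊎ t ≡ l ∷ k ∷ l ∷ k ∷ [] → Linked _≢_ t
  alternating (inj₁ refl) = k≢l ∷ k≢l ∘ sym ∷ k≢l ∷ [-]
  alternating (inj₂ refl) = k≢l ∘ sym ∷ k≢l ∷ k≢l ∘ sym ∷ [-]
  trace-repeat : trace k l (entries α)
    ≡ filter (oneOf? k l) (word-pointers xs ++ pred k ∷ []) ++ k ∷ k ∷ filter (oneOf? k l) (suc k ∷ word-pointers ys)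
  trace-repeat = begin
    trace k l (entries α)
      ≡⟨ cong (filter (oneOf? k l)) (trans (cong word-pointers as≡) (word-pointers-++ xs _)) ⟩
    filter (oneOf? k l) (word-pointers xs ++ pred k ∷ k ∷ k ∷ suc k ∷ word-pointers ys)
      ≡⟨ cong (filter (oneOf? k l)) (++-assoc (word-pointers xs) (pred k ∷ []) _) ⟨
    filter (oneOf? k l) ((word-pointers xs ++ pred k ∷ []) ++ k ∷ k ∷ suc k ∷ word-pointers ys)
      ≡⟨ filter-++ (oneOf? k l) (word-pointers xs ++ pred k ∷ []) _ ⟩
    filter (oneOf? k l) (word-pointers xs ++ pred k ∷ []) ++ filter (oneOf? k l) (k ∷ k ∷ suc k ∷ word-pointers ys)
      ≡⟨ cong (filter (oneOf? k l) (word-pointers xs ++ pred k ∷ []) ++_)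
           (trans (filter-accept (oneOf? k l) (inj₁ refl))
                  (cong (k ∷_) (filter-accept (oneOf? k l) (inj₁ refl)))) ⟩
    filter (oneOf? k l) (word-pointers xs ++ pred k ∷ []) ++ k ∷ k ∷ filter (oneOf? k l) (suc k ∷ word-pointers ys) ∎
    where open ≡-Reasoning

-- Cutting and exchanging blocks

-- A cut at label `t` is made either at the head pointer of the entry t, which then ends the left
-- block, or at the tail pointer of t + 1, which then starts the right block.
Boundary : ℕ → List ℕ → List ℕ → Set
Boundary t b b′ = (∃ λ xs → b ≡ xs ++ t ∷ []) ⊎ (∃ λ ys → b′ ≡ suc t ∷ ys)

-- The default `⊤` only makes the definition total: `cut` yields one block more than the trace has
-- labels, so both lists end together.
Boundaries : List ℕ → List ℕ → List (List ℕ) → Set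
Boundaries (t ∷ ts) b (b′ ∷ bs) = Boundary t b b′ × Boundaries ts b′ bs
Boundaries _        _ _         = ⊤

Boundaries-∷ : ∀ k ts b bs → Boundaries ts b bs → Boundaries ts (k ∷ b) bs
Boundaries-∷ k []       b bs       _       = tt
Boundaries-∷ k (t ∷ ts) b []       _       = tt
Boundaries-∷ k (t ∷ ts) b (_ ∷ bs) (c , d) =
  Sum.map₁ (λ (xs , b≡) → k ∷ xs , cong (k ∷_) b≡) c , d

-- Positive labels matter: an entry 0 has tail label `pred 0`, which is 0, and a cut there would not
-- be followed by 1.
cut-Boundaries : ∀ p q as →
  let b ∷ bs = cut (suc p) (suc q) (word as) in Boundaries (trace (suc p) (suc q) as) b bs
cut-Boundaries p q []           = tt
cut-Boundaries p q (zero  ∷ as) = Boundaries-∷ _ (trace (suc p) (suc q) as) _ _ (cut-Boundaries p q as)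
cut-Boundaries p q (suc k ∷ as) with does (oneOf? (suc p) (suc q) k)
cut-Boundaries p q (suc k ∷ as) | true with does (oneOf? (suc p) (suc q) (suc k))
... | true  = inj₂ (_ , refl) , inj₁ ([] , refl) , cut-Boundaries p q as
... | false = inj₂ (_ , refl) , Boundaries-∷ _ (trace (suc p) (suc q) as) _ _ (cut-Boundaries p q as)
cut-Boundaries p q (suc k ∷ as) | false with does (oneOf? (suc p) (suc q) (suc k))
... | true  = inj₁ ([] , refl) , cut-Boundaries p q as
... | false = Boundaries-∷ _ (trace (suc p) (suc q) as) _ _ (cut-Boundaries p q as)

-- The entry blocks no longer show where p occurs, but they determine which r lie
-- to the right of a given p-boundary; hence one summand per p-boundary.
boundary-parity : ℕ → ℕ → List ℕ → List (List ℕ) → Bool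
boundary-parity p r (t ∷ ts) (b ∷ bs) =
  ((p ≡ᵇ t) ∧ parity r (word-pointers (concat (b ∷ bs)))) xor boundary-parity p r ts bs
boundary-parity p r _        _        = false

concat-cut-word : ∀ p q as → concat (toList (cut p q (word as))) ≡ as
concat-cut-word p q as = trans (concat-cut p q (word as)) (entriesOf-word as)

-- Every occurrence of `x` is a cut. The pointers of the entries to its right are those that follow
-- it, except that a cut at a tail pointer counts this pointer again; its label is `p` or `q`, hence
-- not `r`.
crossings-cut : ∀ {x} p q r as → OneOf p q x → ¬ OneOf p q r →
  crossings x r (word-pointers as) ≡ boundary-parity x r (trace p q as) (List⁺.tail (cut p q (word as)))
crossings-cut {x} p q r as₀ x∈ r∉ = go as₀
  where
  -- The type depends on the same boolean as `cut` and the trace, so abstracting this boolean turns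
  -- it into the one inequality needed in each branch.
  separated : ∀ i → if does (oneOf? p q i) then (r ≡ᵇ i) ≡ false else (x ≡ᵇ i) ≡ false
  separated i = if-does (oneOf? p q i)
    (λ i∈ → ≢⇒≡ᵇ-false {r} {i} (λ { refl → r∉ i∈ })) (λ i∉ → ≢⇒≡ᵇ-false {x} {i} (λ { refl → i∉ x∈ }))

  go : ∀ as → crossings x r (word-pointers as)
              ≡ boundary-parity x r (trace p q as) (List⁺.tail (cut p q (word as)))
  go []       = refl
  go (k ∷ as) with does (oneOf? p q (pred k)) | separated (pred k)
  go (k ∷ as) | true | e₁ with does (oneOf? p q k) | separated k
  ... | true  | e₂ rewrite e₁ | e₂ | concat-cut-word p q as | go as = refl
  ... | false | e₂ rewrite e₁ | e₂ | concat-cut-word p q as | go as = refl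
  go (k ∷ as) | false | e₁ with does (oneOf? p q k) | separated k
  ... | true  | _  rewrite e₁ | concat-cut-word p q as | go as = refl
  ... | false | e₂ rewrite e₁ | e₂ | go as = refl

-- Crossings under a block exchange

parity-suffix : ∀ r u v w → parity r (u ++ v ++ w) xor parity r w ≡ parity r u xor parity r v
parity-suffix r u v w = begin
  parity r (u ++ v ++ w) xor parity r w
    ≡⟨ cong (_xor parity r w) (trans (parity-++ r u (v ++ w)) (cong (parity r u xor_) (parity-++ r v w))) ⟩
  (parity r u xor (parity r v xor parity r w)) xor parity r w
    ≡⟨ solve 3 (λ a b c → (a :+ (b :+ c)) :+ c := a :+ b) refl (parity r u) (parity r v) (parity r w) ⟩
  parity r u xor parity r v ∎
  where
  open ≡-Reasoning
  open xor-∧-Solver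

-- Each of the three pairs of blocks changes order, so the change is the sum of ρ x σ y over
-- distinct blocks x and y. The factored form adds ρ c σ c twice, which cancels.
crossings-reverse : ∀ r s b c d →
  crossings r s (d ++ c ++ b)
  ≡ crossings r s (b ++ c ++ d)
    xor (((parity r b xor parity r c) ∧ (parity s c xor parity s d))
         xor ((parity r c xor parity r d) ∧ (parity s b xor parity s c)))
crossings-reverse r s b c d = begin
  κ (d ++ c ++ b)
    ≡⟨ expand d c b ⟩
  (κ d xor ((κ c xor κ b) xor (ρ c ∧ σ b))) xor (ρ d ∧ (σ c xor σ b))
    ≡⟨ solve 9 (λ kb kc kd rb rc rd sb sc sd →
         (kd :+ ((kc :+ kb) :+ (rc :* sb))) :+ (rd :* (sc :+ sb))
         := ((kb :+ ((kc :+ kd) :+ (rc :* sd))) :+ (rb :* (sc :+ sd)))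
            :+ (((rb :+ rc) :* (sc :+ sd)) :+ ((rc :+ rd) :* (sb :+ sc))))
         refl (κ b) (κ c) (κ d) (ρ b) (ρ c) (ρ d) (σ b) (σ c) (σ d) ⟩
  ((κ b xor ((κ c xor κ d) xor (ρ c ∧ σ d))) xor (ρ b ∧ (σ c xor σ d))) xor δ
    ≡⟨ cong (_xor δ) (expand b c d) ⟨
  κ (b ++ c ++ d) xor δ ∎
  where
  open ≡-Reasoning
  open xor-∧-Solver
  κ ρ σ : List ℕ → Bool
  κ = crossings r s
  ρ = parity r
  σ = parity s
  δ : Bool
  δ = ((ρ b xor ρ c) ∧ (σ c xor σ d)) xor ((ρ c xor ρ d) ∧ (σ b xor σ c))
  expand : ∀ u v w →
    κ (u ++ v ++ w) ≡ (κ u xor ((κ v xor κ w) xor (ρ v ∧ σ w))) xor (ρ u ∧ (σ v xor σ w))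
  expand u v w = trans (crossings-++ r s u (v ++ w))
    (cong₂ (λ k s → (κ u xor k) xor (ρ u ∧ s)) (crossings-++ r s v w) (parity-++ s v w))

parity-reverse : ∀ r b c d → parity r (d ++ c ++ b) ≡ parity r (b ++ c ++ d)
parity-reverse r b c d = begin
  parity r (d ++ c ++ b)
    ≡⟨ expand d c b ⟩
  parity r d xor (parity r c xor parity r b)
    ≡⟨ solve 3 (λ b c d → d :+ (c :+ b) := b :+ (c :+ d)) refl (parity r b) (parity r c) (parity r d) ⟩
  parity r b xor (parity r c xor parity r d)
    ≡⟨ expand b c d ⟨
  parity r (b ++ c ++ d) ∎
  where
  open ≡-Reasoning
  open xor-∧-Solver
  expand : ∀ u v w → parity r (u ++ v ++ w) ≡ parity r u xor (parity r v xor parity r w)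
  expand u v w = trans (parity-++ r u (v ++ w)) (cong (parity r u xor_) (parity-++ r v w))

-- The middle factor enters the expansion only through its two parities and, additively, through its
-- own crossings.
crossings-replace : ∀ r s a {m m′} e δ →
  parity r m ≡ parity r m′ → parity s m ≡ parity s m′ → crossings r s m ≡ crossings r s m′ xor δ →
  crossings r s (a ++ m ++ e) ≡ crossings r s (a ++ m′ ++ e) xor δ
crossings-replace r s a {m} {m′} e δ ρ≡ σ≡ κ≡ = begin
  crossings r s (a ++ m ++ e)
    ≡⟨ expand m ⟩
  term (crossings r s m) (parity r m) (parity s m)
    ≡⟨ cong₂ (λ ρ σ → term (crossings r s m) ρ σ) ρ≡ σ≡ ⟩
  term (crossings r s m) (parity r m′) (parity s m′)
    ≡⟨ cong (λ κ → term κ (parity r m′) (parity s m′)) κ≡ ⟩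
  term (crossings r s m′ xor δ) (parity r m′) (parity s m′)
    ≡⟨ solve 6 (λ ka km ke d x y → (ka :+ (((km :+ d) :+ ke) :+ x)) :+ y
                                := ((ka :+ ((km :+ ke) :+ x)) :+ y) :+ d)
         refl (crossings r s a) (crossings r s m′) (crossings r s e) δ
         (parity r m′ ∧ parity s e) (parity r a ∧ (parity s m′ xor parity s e)) ⟩
  term (crossings r s m′) (parity r m′) (parity s m′) xor δ
    ≡⟨ cong (_xor δ) (expand m′) ⟨
  crossings r s (a ++ m′ ++ e) xor δ ∎
  where
  open ≡-Reasoning
  open xor-∧-Solver
  term : Bool → Bool → Bool → Bool
  term κ ρ σ = (crossings r s a xor ((κ xor crossings r s e) xor (ρ ∧ parity s e)))
               xor (parity r a ∧ (σ xor parity s e))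
  expand : ∀ m → crossings r s (a ++ m ++ e) ≡ term (crossings r s m) (parity r m) (parity s m)
  expand m = trans (crossings-++ r s a (m ++ e))
    (cong₂ (λ k σ → (crossings r s a xor k) xor (parity r a ∧ σ)) (crossings-++ r s m e) (parity-++ s m e))

crossings-exchange-++ : ∀ r s a b c d e →
  crossings r s (a ++ d ++ c ++ b ++ e)
  ≡ crossings r s (a ++ b ++ c ++ d ++ e)
    xor (((parity r b xor parity r c) ∧ (parity s c xor parity s d))
         xor ((parity r c xor parity r d) ∧ (parity s b xor parity s c)))
crossings-exchange-++ r s a b c d e = begin
  crossings r s (a ++ d ++ c ++ b ++ e)
    ≡⟨ cong (λ z → crossings r s (a ++ z)) (assoc d c b) ⟩
  crossings r s (a ++ (d ++ c ++ b) ++ e)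
    ≡⟨ crossings-replace r s a e _ (parity-reverse r b c d) (parity-reverse s b c d)
         (crossings-reverse r s b c d) ⟩
  crossings r s (a ++ (b ++ c ++ d) ++ e) xor _
    ≡⟨ cong (λ z → crossings r s (a ++ z) xor _) (assoc b c d) ⟨
  crossings r s (a ++ b ++ c ++ d ++ e) xor _ ∎
  where
  open ≡-Reasoning
  assoc : ∀ u v w → u ++ v ++ w ++ e ≡ (u ++ v ++ w) ++ e
  assoc u v w = trans (cong (u ++_) (sym (++-assoc v w e))) (sym (++-assoc u (v ++ w) e))

word-pointers-++⁵ : ∀ a b c d e → word-pointers (a ++ b ++ c ++ d ++ e) ≡
  word-pointers a ++ word-pointers b ++ word-pointers c ++ word-pointers d ++ word-pointers e
word-pointers-++⁵ a b c d e =
  trans (word-pointers-++ a _) (cong (word-pointers a ++_)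
  (trans (word-pointers-++ b _) (cong (word-pointers b ++_)
  (trans (word-pointers-++ c _) (cong (word-pointers c ++_)
  (word-pointers-++ d e))))))

parity-word-suffix : ∀ r u v w →
  parity r (word-pointers (u ++ v ++ w)) xor parity r (word-pointers w)
  ≡ parity r (word-pointers u) xor parity r (word-pointers v)
parity-word-suffix r u v w = trans
  (cong (λ z → parity r z xor parity r (word-pointers w))
    (trans (word-pointers-++ u (v ++ w)) (cong (word-pointers u ++_) (word-pointers-++ v w))))
  (parity-suffix r (word-pointers u) (word-pointers v) (word-pointers w))

module _ {p q : ℕ} (p≢q : p ≢ q) where

  -- `p` is cut before B and before D. The occurrences of `r` in D and E are counted from both cuts
  -- and cancel, leaving those between the two occurrences of `p`. Likewise `q` encloses C and D.
  boundary-parityˡ : ∀ r B C D E →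
    boundary-parity p r (p ∷ q ∷ p ∷ q ∷ []) (B ∷ C ∷ D ∷ E ∷ [])
    ≡ parity r (word-pointers B) xor parity r (word-pointers C)
  boundary-parityˡ r B C D E = trans
    (cong₂ (λ t f → (t ∧ x₁) xor ((f ∧ x₂) xor ((t ∧ x₃) xor ((f ∧ x₄) xor false))))
      (≡ᵇ-refl p) (≢⇒≡ᵇ-false p≢q))
    (trans (cong (x₁ xor_) (xor-identityʳ x₃)) (parity-word-suffix r B C (concat (D ∷ E ∷ []))))
    where
    x₁ x₂ x₃ x₄ : Bool
    x₁ = parity r (word-pointers (concat (B ∷ C ∷ D ∷ E ∷ [])))
    x₂ = parity r (word-pointers (concat (C ∷ D ∷ E ∷ [])))
    x₃ = parity r (word-pointers (concat (D ∷ E ∷ [])))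
    x₄ = parity r (word-pointers (concat (E ∷ [])))

  boundary-parityʳ : ∀ r B C D E →
    boundary-parity q r (p ∷ q ∷ p ∷ q ∷ []) (B ∷ C ∷ D ∷ E ∷ [])
    ≡ parity r (word-pointers C) xor parity r (word-pointers D)
  boundary-parityʳ r B C D E = trans
    (cong₂ (λ t f → (f ∧ x₁) xor ((t ∧ x₂) xor ((f ∧ x₃) xor ((t ∧ x₄) xor false))))
      (≡ᵇ-refl q) (≢⇒≡ᵇ-false (p≢q ∘ sym)))
    (trans (cong (x₂ xor_) (xor-identityʳ x₄)) (parity-word-suffix r C D (concat (E ∷ []))))
    where
    x₁ x₂ x₃ x₄ : Bool
    x₁ = parity r (word-pointers (concat (B ∷ C ∷ D ∷ E ∷ [])))
    x₂ = parity r (word-pointers (concat (C ∷ D ∷ E ∷ [])))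
    x₃ = parity r (word-pointers (concat (D ∷ E ∷ [])))
    x₄ = parity r (word-pointers (concat (E ∷ [])))

  -- The blocks are arbitrary, so that matching on the length proof lets `exchange` reduce. Pointers
  -- move with their entries, so the pointer word is permuted blockwise.
  crossings-exchange : ∀ bs len r s →
    let π = λ x y → boundary-parity x y (p ∷ q ∷ p ∷ q ∷ []) (List⁺.tail bs) in
    crossings r s (word-pointers (exchange bs len))
    ≡ crossings r s (word-pointers (concat (toList bs))) xor ((π p r ∧ π q s) xor (π q r ∧ π p s))
  crossings-exchange (A ∷ B ∷ C ∷ D ∷ E ∷ []) refl r s = begin
    crossings r s (word-pointers (A ++ D ++ C ++ B ++ E))
      ≡⟨ cong (crossings r s) (word-pointers-++⁵ A D C B E) ⟩
    crossings r s (w A ++ w D ++ w C ++ w B ++ w E)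
      ≡⟨ crossings-exchange-++ r s (w A) (w B) (w C) (w D) (w E) ⟩
    crossings r s (w A ++ w B ++ w C ++ w D ++ w E)
      xor (((parity r (w B) xor parity r (w C)) ∧ (parity s (w C) xor parity s (w D)))
           xor ((parity r (w C) xor parity r (w D)) ∧ (parity s (w B) xor parity s (w C))))
      ≡⟨ cong₂ _xor_ (cong (crossings r s) (sym unexchanged))
           (sym (cong₂ _xor_
             (cong₂ _∧_ (boundary-parityˡ r B C D E) (boundary-parityʳ s B C D E))
             (cong₂ _∧_ (boundary-parityʳ r B C D E) (boundary-parityˡ s B C D E)))) ⟩
    _ ∎
    where
    open ≡-Reasoning
    w : List ℕ → List ℕ
    w = word-pointers
    unexchanged : w (concat (A ∷ B ∷ C ∷ D ∷ E ∷ [])) ≡ w A ++ w B ++ w C ++ w D ++ w E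
    unexchanged = trans (cong (λ z → w (A ++ B ++ C ++ D ++ z)) (++-identityʳ E))
                        (word-pointers-++⁵ A B C D E)

-- Adjacency created by the exchange

Adjacent-++ˡ : ∀ {k} xs {ys} → Adjacent k ys → Adjacent k (xs ++ ys)
Adjacent-++ˡ xs (us , vs , refl) = xs ++ us , vs , sym (++-assoc xs us _)

Adjacent-join : ∀ {k b c} → (∃ λ xs → b ≡ xs ++ k ∷ []) → (∃ λ ys → c ≡ suc k ∷ ys) → Adjacent k (b ++ c)
Adjacent-join (xs , refl) (ys , refl) = xs , ys , ++-assoc xs _ _

starts-++ : ∀ {k : ℕ} {b} c → (∃ λ ys → b ≡ k ∷ ys) → ∃ λ ys → b ++ c ≡ k ∷ ys
starts-++ c (ys , refl) = ys ++ c , refl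

module _ {A : Set} {x : A} where

  last-∈ : ∀ {b} → (∃ λ xs → b ≡ xs ++ x ∷ []) → x ∈ b
  last-∈ (xs , refl) = ∈-++⁺ʳ xs (here refl)

  head-∈ : ∀ {b} → (∃ λ ys → b ≡ x ∷ ys) → x ∈ b
  head-∈ (_ , refl) = here refl

Unique-++ʳ : ∀ {A : Set} (xs : List A) {ys} → Unique (xs ++ ys) → Unique ys
Unique-++ʳ []       ys!       = ys!
Unique-++ʳ (_ ∷ xs) (_ ∷ us!) = Unique-++ʳ xs us!

-- At one of its two boundaries p follows the entry p, at the other it precedes
-- the entry p + 1; the exchange glues these two boundaries together.
exchange-Adjacent : ∀ {p q} bs len → Unique (concat (toList bs)) →
  Boundaries (p ∷ q ∷ p ∷ q ∷ []) (List⁺.head bs) (List⁺.tail bs) →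
  Adjacent p (exchange bs len) × Adjacent q (exchange bs len)
exchange-Adjacent {p} {q} (A ∷ B ∷ C ∷ D ∷ E ∷ []) refl es! (AB , BC , CD , DE , _) =
  adjacent-p AB CD , adjacent-q BC DE
  where
  es!ᴮ : Unique (B ++ C ++ D ++ E ++ [])
  es!ᴮ = Unique-++ʳ A es!
  es!ᶜ : Unique (C ++ D ++ E ++ [])
  es!ᶜ = Unique-++ʳ B es!ᴮ

  adjacent-p : Boundary p A B → Boundary p C D → Adjacent p (A ++ D ++ C ++ B ++ E)
  -- In the new order A meets D and C meets B; these are the two possible joints for `p`. For `q`
  -- they are B with E and D with C.
  adjacent-p (inj₁ a) (inj₂ d) = Adjacent-join a (starts-++ _ d)
  adjacent-p (inj₂ b) (inj₁ c) = Adjacent-++ˡ A (Adjacent-++ˡ D (Adjacent-join c (starts-++ _ b)))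
  -- Two boundaries of the same type would place one entry in two different blocks.
  adjacent-p (inj₁ a) (inj₁ c) =
    ⊥-elim (Unique-++⇒disjoint A es! (last-∈ a) (∈-++⁺ʳ B (∈-++⁺ˡ (last-∈ c))))
  adjacent-p (inj₂ b) (inj₂ d) =
    ⊥-elim (Unique-++⇒disjoint B es!ᴮ (head-∈ b) (∈-++⁺ʳ C (∈-++⁺ˡ (head-∈ d))))

  adjacent-q : Boundary q B C → Boundary q D E → Adjacent q (A ++ D ++ C ++ B ++ E)
  adjacent-q (inj₁ b) (inj₂ e) = Adjacent-++ˡ A (Adjacent-++ˡ D (Adjacent-++ˡ C (Adjacent-join b e)))
  adjacent-q (inj₂ c) (inj₁ d) = Adjacent-++ˡ A (Adjacent-join d (starts-++ _ c))
  adjacent-q (inj₁ b) (inj₁ d) =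
    ⊥-elim (Unique-++⇒disjoint B es!ᴮ (last-∈ b) (∈-++⁺ʳ C (∈-++⁺ˡ (last-∈ d))))
  adjacent-q (inj₂ c) (inj₂ e) =
    ⊥-elim (Unique-++⇒disjoint C es!ᶜ (head-∈ c) (∈-++⁺ʳ D (∈-++⁺ˡ (head-∈ e))))

-- The cds move on a permutation

module _ (α : Perm n) (p q : Pointer n) (I : Interlock α p q) where

  private
    p′ = label p
    q′ = label q
    bs = blocks p q α
    p≢q : p ≢ q
    p≢q = proj₁ I

    concat-blocks : concat (toList bs) ≡ entries α
    concat-blocks = concat-cut-word p′ q′ (entries α)

    blocks-Boundaries : ∀ {ts} → trace p′ q′ (entries α) ≡ ts →
                        Boundaries ts (List⁺.head bs) (List⁺.tail bs)
    blocks-Boundaries refl = cut-Boundaries (toℕ p) (toℕ q) (entries α)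

  cds-Adjacent : Adjacent p′ (entries (cds p q α I)) × Adjacent q′ (entries (cds p q α I))
  cds-Adjacent = go (proj₂ I)
    where
    len = fiveBlocks p q α I
    es! : Unique (concat (toList bs))
    es! = subst Unique (sym concat-blocks) (entries-Unique α)
    go : trace p′ q′ (entries α) ≡ p′ ∷ q′ ∷ p′ ∷ q′ ∷ [] ⊎ trace p′ q′ (entries α) ≡ q′ ∷ p′ ∷ q′ ∷ p′ ∷ [] →
         Adjacent p′ (entries (cds p q α I)) × Adjacent q′ (entries (cds p q α I))
    go (inj₁ t≡) = exchange-Adjacent bs len es! (blocks-Boundaries t≡)
    go (inj₂ t≡) = let aq , ap = exchange-Adjacent bs len es! (blocks-Boundaries t≡) in ap , aq

  Other⇒¬OneOf : ∀ {r} → Other (Γ n α) p q r → ¬ OneOf p′ q′ (label r)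
  Other⇒¬OneOf (r≢p , r≢q) = Sum.[ r≢p ∘ label-injective , r≢q ∘ label-injective ]

  -- The block exchange formula is expressed in boundary parities. Since `r` and `s` are not cut
  -- labels, `crossings-cut` turns these into crossings in `α` itself.
  crosses-cds : ∀ {r s} → Other (Γ n α) p q r → Other (Γ n α) p q s →
    crosses (cds p q α I) r s
    ≡ crosses α r s xor ((crosses α p r ∧ crosses α q s) xor (crosses α q r ∧ crosses α p s))
  crosses-cds {r} {s} r∉ s∉ = go (proj₂ I)
    where
    len = fiveBlocks p q α I
    π : ℕ → ℕ → List ℕ → Bool
    π x y ts = boundary-parity x y ts (List⁺.tail bs)

    π-crosses : ∀ {x y ts} → OneOf p′ q′ (label x) → Other (Γ n α) p q y →
                trace p′ q′ (entries α) ≡ ts → π (label x) (label y) ts ≡ crosses α x y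
    π-crosses {y = y} x∈ y∉ refl = sym (crossings-cut p′ q′ (label y) (entries α) x∈ (Other⇒¬OneOf y∉))

    exchanged : ∀ {x y} → x ≢ y → OneOf p′ q′ (label x) → OneOf p′ q′ (label y) →
      trace p′ q′ (entries α) ≡ label x ∷ label y ∷ label x ∷ label y ∷ [] →
      crosses (cds p q α I) r s
      ≡ crosses α r s xor ((crosses α x r ∧ crosses α y s) xor (crosses α y r ∧ crosses α x s))
    exchanged x≢y x∈ y∈ t≡ = trans
      (crossings-exchange (x≢y ∘ label-injective) bs len (label r) (label s))
      (cong₂ _xor_ (cong (crossings (label r) (label s) ∘ word-pointers) concat-blocks)
        (cong₂ _xor_ (cong₂ _∧_ (π-crosses x∈ r∉ t≡) (π-crosses y∈ s∉ t≡))
                     (cong₂ _∧_ (π-crosses y∈ r∉ t≡) (π-crosses x∈ s∉ t≡))))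

    go : trace p′ q′ (entries α) ≡ p′ ∷ q′ ∷ p′ ∷ q′ ∷ [] ⊎ trace p′ q′ (entries α) ≡ q′ ∷ p′ ∷ q′ ∷ p′ ∷ [] →
      crosses (cds p q α I) r s
      ≡ crosses α r s xor ((crosses α p r ∧ crosses α q s) xor (crosses α q r ∧ crosses α p s))
    go (inj₁ t≡) = exchanged p≢q (inj₁ refl) (inj₂ refl) t≡
    -- If `q` comes first, the two products trade places.
    go (inj₂ t≡) = trans (exchanged (p≢q ∘ sym) (inj₂ refl) (inj₁ refl) t≡)
      (cong (crosses α r s xor_) (xor-comm (crosses α q r ∧ crosses α p s) _))

-- The update rule of gcds over 𝔽₂

bit : Bool → ℕ
bit b = if b then 1 else 0

update : (listed₁ listed₂ share even edge : Bool) → Bool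
update true true true true  e = e
update true true true false e = not e
update true true false _    e = not e
update _    _    _     _    e = e

-- (a , b) and (c , d) record the adjacency of the two vertices to x and y. The added term is the
-- determinant of these vectors over 𝔽₂: it is 1 exactly when they are nonzero and distinct. Two
-- nonzero vectors without a shared column are the two unit vectors; with a shared column, an odd
-- total means that exactly one of them is (1 , 1), and an even total means that they are equal.
update-polynomial : ∀ a b c d e →
  update (a ∨ b) (c ∨ d) ((a ∧ c) ∨ (b ∧ d)) (does (2 ∣? ((bit a + bit b) + (bit c + bit d)))) e
  ≡ e xor ((a ∧ d) xor (b ∧ c))
update-polynomial false false c     d     e = sym (xor-identityʳ e)
update-polynomial true  false false false e = sym (xor-identityʳ e)
update-polynomial true  false false true  e = xor-comm true e
update-polynomial true  false true  false e = sym (xor-identityʳ e)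
update-polynomial true  false true  true  e = xor-comm true e
update-polynomial false true  false false e = sym (xor-identityʳ e)
update-polynomial false true  false true  e = sym (xor-identityʳ e)
update-polynomial false true  true  false e = xor-comm true e
update-polynomial false true  true  true  e = xor-comm true e
update-polynomial true  true  false false e = sym (xor-identityʳ e)
update-polynomial true  true  false true  e = xor-comm true e
update-polynomial true  true  true  false e = xor-comm true e
update-polynomial true  true  true  true  e = sym (xor-identityʳ e)

module _ {m : ℕ} (G : Graph m) where

  ∈-column : ∀ x {y v} → v ≢ y → v ∈ column G x y ⇔ Edge G x v
  ∈-column x {y} {v} v≢y = mk⇔
    (λ v∈ → proj₁ (proj₂ (∈-filter⁻ (λ w → edge? G x w ×-dec ¬? (w Fin.≟ y)) {xs = allFin m} v∈)))
    (λ e → ∈-filter⁺ (λ w → edge? G x w ×-dec ¬? (w Fin.≟ y)) (∈-allFin v) (e , v≢y))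

  occurrences-column : ∀ x {y v} → v ≢ y → occurrences G v (column G x y) ≡ bit (does (edge? G x v))
  occurrences-column x {y} {v} v≢y with edge? G x v
  ... | yes e = count-Unique Fin._≟_
    (Unique.filter⁺ (λ w → edge? G x w ×-dec ¬? (w Fin.≟ y)) (Unique.allFin⁺ m))
    (Equivalence.from (∈-column x v≢y) e)
  ... | no ¬e = count-∉ Fin._≟_ (¬e ∘ Equivalence.to (∈-column x v≢y))

  module _ {x y : Fin m} where

    occurrences-masterList : ∀ {v} → Other G x y v →
      occurrences G v (masterList G x y) ≡ bit (does (edge? G x v)) + bit (does (edge? G y v))
    occurrences-masterList {v} (v≢x , v≢y) = trans
      (cong length (filter-++ (v Fin.≟_) (column G x y) (column G y x)))
      (trans (length-++ (filter (v Fin.≟_) (column G x y)))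
        (cong₂ _+_ (occurrences-column x v≢y) (occurrences-column y v≢x)))

    ∈-masterList : ∀ {v} → Other G x y v → Listed G x y v ⇔ (Edge G x v ⊎ Edge G y v)
    ∈-masterList (v≢x , v≢y) = mk⇔
      (Sum.map (Equivalence.to (∈-column x v≢y)) (Equivalence.to (∈-column y v≢x))
        ∘ ∈-++⁻ (column G x y))
      Sum.[ ∈-++⁺ˡ ∘ Equivalence.from (∈-column x v≢y)
          , ∈-++⁺ʳ (column G x y) ∘ Equivalence.from (∈-column y v≢x) ]

    share⇔ : ∀ {p q} → Other G x y p → Other G x y q →
      ShareColumn G x y p q ⇔ ((Edge G x p × Edge G x q) ⊎ (Edge G y p × Edge G y q))
    share⇔ (p≢x , p≢y) (q≢x , q≢y) =
      (∈-column x p≢y ×-⇔ ∈-column x q≢y) ⊎-⇔ (∈-column y p≢x ×-⇔ ∈-column y q≢x)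

    -- The case split of `updated?` is repeated so that it reduces; afterwards only booleans remain,
    -- and each can be replaced through an equivalence.
    does-updated? : ∀ p q → does (updated? G x y p q) ≡
      update (does (listed? G x y p)) (does (listed? G x y q)) (does (share? G x y p q))
             (does (2 ∣? total G x y p q)) (does (edge? G p q))
    does-updated? p q with listed? G x y p | listed? G x y q
    ... | no _  | _     = refl
    ... | yes _ | no _  = refl
    ... | yes _ | yes _ with share? G x y p q | 2 ∣? total G x y p q | edge? G p q
    ...   | no ¬s | _     | no _  rewrite dec-false (share? G x y p q) ¬s = refl
    ...   | no ¬s | _     | yes _ rewrite dec-false (share? G x y p q) ¬s = refl
    ...   | yes s | yes t | yes _ rewrite dec-true (share? G x y p q) s | dec-true (2 ∣? total G x y p q) t = refl
    ...   | yes s | yes t | no _  rewrite dec-true (share? G x y p q) s | dec-true (2 ∣? total G x y p q) t = refl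
    ...   | yes s | no ¬t | yes _ rewrite dec-true (share? G x y p q) s | dec-false (2 ∣? total G x y p q) ¬t = refl
    ...   | yes s | no ¬t | no _  rewrite dec-true (share? G x y p q) s | dec-false (2 ∣? total G x y p q) ¬t = refl

    -- Away from x and y, four adjacency bits determine membership in the master list, column
    -- sharing and the total.
    updated-polynomial : ∀ {p q} → Other G x y p → Other G x y q →
      does (updated? G x y p q) ≡ does (edge? G p q) xor
        ((does (edge? G x p) ∧ does (edge? G y q)) xor (does (edge? G y p) ∧ does (edge? G x q)))
    updated-polynomial {p} {q} op oq = begin
      does (updated? G x y p q)
        ≡⟨ does-updated? p q ⟩
      update (does (listed? G x y p)) (does (listed? G x y q)) (does (share? G x y p q))
             (does (2 ∣? total G x y p q)) e
        ≡⟨ cong₂ (λ l₁ l₂ → update l₁ l₂ (does (share? G x y p q)) (does (2 ∣? total G x y p q)) e)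
             (does-⇔ (∈-masterList op) (listed? G x y p) (edge? G x p ⊎-dec edge? G y p))
             (does-⇔ (∈-masterList oq) (listed? G x y q) (edge? G x q ⊎-dec edge? G y q)) ⟩
      update (a ∨ b) (c ∨ d) (does (share? G x y p q)) (does (2 ∣? total G x y p q)) e
        ≡⟨ cong₂ (λ s t → update (a ∨ b) (c ∨ d) s (does (2 ∣? t)) e)
             (does-⇔ (share⇔ op oq) (share? G x y p q)
               ((edge? G x p ×-dec edge? G x q) ⊎-dec (edge? G y p ×-dec edge? G y q)))
             (cong₂ _+_ (occurrences-masterList op) (occurrences-masterList oq)) ⟩
      update (a ∨ b) (c ∨ d) ((a ∧ c) ∨ (b ∧ d)) (does (2 ∣? ((bit a + bit b) + (bit c + bit d)))) e
        ≡⟨ update-polynomial a b c d e ⟩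
      e xor ((a ∧ d) xor (b ∧ c)) ∎
      where
      open ≡-Reasoning
      a b c d e : Bool
      a = does (edge? G x p)
      b = does (edge? G y p)
      c = does (edge? G x q)
      d = does (edge? G y q)
      e = does (edge? G p q)

-- Comparison of the two graphs

does-≟-true : ∀ b → does (b Bool.≟ true) ≡ b
does-≟-true true  = refl
does-≟-true false = refl

does-interlock? : (α : Perm n) {r s : Pointer n} → r ≢ s → does (interlock? α r s) ≡ crosses α r s
does-interlock? α {r} {s} r≢s = trans
  (does-⇔ (interlock⇔crosses α r≢s) (interlock? α r s) (crosses α r s Bool.≟ true))
  (does-≟-true (crosses α r s))

does-true⇒ : ∀ {A : Set} (a? : Dec A) → does a? ≡ true → A
does-true⇒ (yes a) _ = a

theorem2 : (n : ℕ) → .{{_ : NonZero n}} → (α : Perm n) (p q : Pointer n) →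
    (I : Interlock α p q) →
    Γ n (cds p q α I) ≈ᴳ gcds (Γ n α) p q I
theorem2 n α p q I u v = mk⇔ to from
  where
  β : Perm n
  β = cds p q α I

  -- `gcds` isolates p and q by definition; in `β` they are isolated because their entries have
  -- become adjacent.
  isolated : ∀ {r s} → Interlock β r s → Other (Γ n α) p q r
  isolated {s = s} J =
    (λ { refl → Adjacent⇒¬Interlock β p s (proj₁ (cds-Adjacent α p q I)) J }) ,
    (λ { refl → Adjacent⇒¬Interlock β q s (proj₂ (cds-Adjacent α p q I)) J })

  -- For the remaining pointers it suffices to compare decisions: both equal the same polynomial in
  -- the crossings of `α`.
  does-agree : u ≢ v → Other (Γ n α) p q u → Other (Γ n α) p q v →
               does (updated? (Γ n α) p q u v) ≡ does (interlock? β u v)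
  does-agree u≢v ou@(u≢p , u≢q) ov@(v≢p , v≢q) = begin
    does (updated? (Γ n α) p q u v)
      ≡⟨ updated-polynomial (Γ n α) ou ov ⟩
    does (interlock? α u v) xor
      ((does (interlock? α p u) ∧ does (interlock? α q v)) xor
       (does (interlock? α q u) ∧ does (interlock? α p v)))
      ≡⟨ cong₂ _xor_ (does-interlock? α u≢v) (cong₂ _xor_
           (cong₂ _∧_ (does-interlock? α (u≢p ∘ sym)) (does-interlock? α (v≢q ∘ sym)))
           (cong₂ _∧_ (does-interlock? α (u≢q ∘ sym)) (does-interlock? α (v≢p ∘ sym)))) ⟩
    crosses α u v xor ((crosses α p u ∧ crosses α q v) xor (crosses α q u ∧ crosses α p v))
      ≡⟨ crosses-cds α p q I ou ov ⟨
    crosses β u v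
      ≡⟨ does-interlock? β u≢v ⟨
    does (interlock? β u v) ∎
    where open ≡-Reasoning

  to : Interlock β u v → GcdsEdge (Γ n α) p q u v
  to J@(u≢v , _) = u≢v , ou , ov ,
    does-true⇒ (updated? (Γ n α) p q u v)
      (trans (does-agree u≢v ou ov) (dec-true (interlock? β u v) J))
    where
    ou = isolated J
    ov = isolated (interlock-sym β {u} {v} J)

  from : GcdsEdge (Γ n α) p q u v → Interlock β u v
  from (u≢v , ou , ov , updated) = does-true⇒ (interlock? β u v)
    (trans (sym (does-agree u≢v ou ov)) (dec-true (updated? (Γ n α) p q u v) updated))
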